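{- Assume the following statement: there is an algorithm which takes as input a Diophantine equation $D(x_1,\ldots,x_p)=0$ and returns an integer $b\geqslant 2$ such that $b$ is greater than the number of rational solutions of the equation whenever the set of its rational solutions is finite. Then the question whether or not a given Diophantine equation has only finitely many rational solutions is decidable by a single query to an oracle that decides whether or not a given Diophantine equation has an integer solution.
   Context: A Diophantine equation is an equation $D(x_1,\ldots,x_p)=0$ with $D \in \mathbb{Z}[x_1,\ldots,x_p]$. -}

module Defs where

open import Data.Nat using (ℕ; _<_)
open import Data.Fin using (Fin)
open import Data.Integer as ℤ using (ℤ)
open import Data.Rational as ℚ using (ℚ; 0ℚ)
open import Data.Vec using (Vec; lookup)
open import Data.List using (List; length)
open import Data.List.Relation.Unary.All using (All)
open import Data.List.Relation.Unary.Unique.Propositional using (Unique)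
open import Data.List.Membership.Propositional using (_∈_)
open import Data.Product using (Σ; ∃; _×_; _,_; proj₁; proj₂)
open import Relation.Binary.PropositionalEquality using (_≡_)

data Poly (p : ℕ) : Set where
  con  : ℤ → Poly p
  var  : Fin p → Poly p
  _⊕_  : Poly p → Poly p → Poly p
  _⊗_  : Poly p → Poly p → Poly p

-- A Diophantine equation D(x₁,…,xₚ) = 0: the number of variables p
-- together with the polynomial D ∈ ℤ[x₁,…,xₚ].
DiophEq : Set
DiophEq = Σ ℕ Poly

evalℤ : ∀ {p} → Poly p → Vec ℤ p → ℤ
evalℤ (con c) x = c
evalℤ (var i) x = lookup x i
evalℤ (f ⊕ g) x = evalℤ f x ℤ.+ evalℤ g x
evalℤ (f ⊗ g) x = evalℤ f x ℤ.* evalℤ g x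

evalℚ : ∀ {p} → Poly p → Vec ℚ p → ℚ
evalℚ (con c) x = c ℚ./ 1
evalℚ (var i) x = lookup x i
evalℚ (f ⊕ g) x = evalℚ f x ℚ.+ evalℚ g x
evalℚ (f ⊗ g) x = evalℚ f x ℚ.* evalℚ g x

IsRatSol : (D : DiophEq) → Vec ℚ (proj₁ D) → Set
IsRatSol (p , f) x = evalℚ f x ≡ 0ℚ

HasIntSol : DiophEq → Set
HasIntSol D = ∃ λ (x : Vec ℤ (proj₁ D)) → evalℤ (proj₂ D) x ≡ ℤ.+ 0

RatSolCount : DiophEq → ℕ → Set
RatSolCount D n =
  ∃ λ (L : List (Vec ℚ (proj₁ D))) →
    Unique L × All (IsRatSol D) L × (∀ x → IsRatSol D x → x ∈ L) × length L ≡ n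

FinitelyManyRatSols : DiophEq → Set
FinitelyManyRatSols D = ∃ λ n → RatSolCount D n

{-# OPTIONS --safe #-}
-- A family of b rational points can be described by integers: the k-th point is
-- a_k / d_k² with d_k ≠ 0.  It solves f = 0 iff the homogenization H_k of f
-- vanishes at (d_k², a_k), and two points differ iff some a_kj d_l² − a_lj d_k² is
-- nonzero.  "All d_k ≠ 0 and the points are pairwise distinct" says that one
-- integer product P is nonzero, and the nonzero integers are exactly the values of
-- (2u − 1)(3v − 1).  So there are b distinct rational solutions iff the single
-- equation (P − (2u − 1)(3v − 1))² + Σ_k H_k² = 0 has an integer solution.  For b = B D,
-- "finitely many" means "fewer than b", so the oracle's answer for this equation
-- is the negation of finiteness; excluded middle is what turns "not finitely many"
-- into b distinct solutions.
module Submission where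

open import Defs
open import Data.Nat using (ℕ; _≤_; _<_)
open import Data.Bool using (Bool; true)
open import Data.Product using (Σ; _×_)
open import Function.Bundles using (_⇔_)
open import Relation.Binary.PropositionalEquality using (_≡_)
open import Axiom.ExcludedMiddle using (ExcludedMiddle)
open import Level using (0ℓ)

open import Data.Bool using (false; not)
open import Data.Empty using (⊥-elim)
open import Data.Fin as F using (Fin; zero; suc; combine; remQuot)
import Data.Fin.Properties as FP
open import Data.Integer as ℤ using (ℤ; +_; +[1+_]; -[1+_]; ∣_∣; 0ℤ; 1ℤ; -1ℤ)
import Data.Integer.Properties as ℤP
open import Data.Integer.Tactic.RingSolver using (solve-∀)
open import Data.List as List using (List; []; _∷_; length)
open import Data.List.Membership.Propositional using (_∈_; _∉_)
open import Data.List.Membership.Propositional.Properties using (∈-lookup)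
open import Data.List.Relation.Unary.All as All using (All; []; _∷_)
open import Data.List.Relation.Unary.AllPairs using ([]; _∷_)
import Data.List.Relation.Unary.Any as Any
open import Data.List.Relation.Unary.Any.Properties using (lookup-index)
open import Data.List.Relation.Unary.Unique.Propositional using (Unique)
open import Data.Nat as ℕ using (zero; suc)
open import Data.Nat.Induction using (<-rec)
import Data.Nat.Properties as ℕP
open import Data.Product using (∃; ∃₂; _,_; proj₁; proj₂)
open import Data.Rational as ℚ using (ℚ; 0ℚ; toℚᵘ; fromℚᵘ)
import Data.Rational.Properties as ℚP
open import Data.Rational.Unnormalised as ℚᵘ using (ℚᵘ; mkℚᵘ; ↥_; ↧_; _≃_; *≡*)
import Data.Rational.Unnormalised.Properties as ℚᵘP
open import Data.Sum using (_⊎_; inj₁; inj₂; [_,_]′)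
open import Data.Vec using (Vec; []; _∷_; lookup; tabulate)
import Data.Vec.Properties as VP
open import Function using (_∘_; id)
open import Function.Bundles using (mk⇔; Equivalence)
open import Function.Construct.Composition using (_⇔-∘_)
open import Function.Construct.Symmetry using (⇔-sym)
open import Function.Definitions using (Injective)
open import Relation.Binary.PropositionalEquality
  using (_≢_; refl; sym; trans; cong; cong₂; subst; module ≡-Reasoning)
open import Relation.Nullary using (¬_; yes; no)
open import Relation.Nullary.Decidable using (decidable-stable)

nonzeroForm : ℤ → ℤ → ℤ
nonzeroForm u v = (+ 2 ℤ.* u ℤ.- 1ℤ) ℤ.* (+ 3 ℤ.* v ℤ.- 1ℤ)

[2+k]*u-1≢0 : ∀ k u → +[1+ suc k ] ℤ.* u ℤ.- 1ℤ ≢ 0ℤ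
[2+k]*u-1≢0 k u eq
  with ℕP.m*n≡1⇒m≡1 (suc (suc k)) ∣ u ∣
         (trans (sym (ℤP.abs-* +[1+ suc k ] u)) (cong ∣_∣ (ℤP.i-j≡0⇒i≡j (+[1+ suc k ] ℤ.* u) 1ℤ eq)))
... | ()

nonzeroForm≢0 : ∀ u v → nonzeroForm u v ≢ 0ℤ
nonzeroForm≢0 u v eq with ℤP.i*j≡0⇒i≡0∨j≡0 (+ 2 ℤ.* u ℤ.- 1ℤ) eq
... | inj₁ 2u-1≡0 = [2+k]*u-1≢0 0 u 2u-1≡0
... | inj₂ 3v-1≡0 = [2+k]*u-1≢0 1 v 3v-1≡0

even-or-odd : ∀ n → ∃ λ h → n ≡ h ℕ.+ h ⊎ n ≡ suc (h ℕ.+ h)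
even-or-odd zero = 0 , inj₁ refl
even-or-odd (suc n) with even-or-odd n
... | h , inj₁ n≡2h   = h , inj₂ (cong suc n≡2h)
... | h , inj₂ n≡2h+1 = suc h , inj₁ (cong suc (trans n≡2h+1 (sym (ℕP.+-suc h h))))

-- Odd numbers are nonzeroForm (- h) 0; doubling is absorbed by v ↦ 1 - 2v and
-- negation by u ↦ 1 - u.
private
  odd-nonzeroForm : ∀ h → 1ℤ ℤ.+ h ℤ.+ h ≡ (+ 2 ℤ.* (ℤ.- h) ℤ.- 1ℤ) ℤ.* (+ 3 ℤ.* 0ℤ ℤ.- 1ℤ)
  odd-nonzeroForm = solve-∀

  double-nonzeroForm : ∀ u v →
    (+ 2 ℤ.* u ℤ.- 1ℤ) ℤ.* (+ 3 ℤ.* v ℤ.- 1ℤ) ℤ.+ (+ 2 ℤ.* u ℤ.- 1ℤ) ℤ.* (+ 3 ℤ.* v ℤ.- 1ℤ)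
      ≡ (+ 2 ℤ.* (1ℤ ℤ.- u) ℤ.- 1ℤ) ℤ.* (+ 3 ℤ.* (1ℤ ℤ.- + 2 ℤ.* v) ℤ.- 1ℤ)
  double-nonzeroForm = solve-∀

  neg-nonzeroForm : ∀ u v →
    ℤ.- ((+ 2 ℤ.* u ℤ.- 1ℤ) ℤ.* (+ 3 ℤ.* v ℤ.- 1ℤ)) ≡ (+ 2 ℤ.* (1ℤ ℤ.- u) ℤ.- 1ℤ) ℤ.* (+ 3 ℤ.* v ℤ.- 1ℤ)
  neg-nonzeroForm = solve-∀

positive⇒nonzeroForm : ∀ n → ∃₂ λ u v → +[1+ n ] ≡ nonzeroForm u v
positive⇒nonzeroForm = <-rec _ step
  where
  step : ∀ n → (∀ {m} → m < n → ∃₂ λ u v → +[1+ m ] ≡ nonzeroForm u v) →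
         ∃₂ λ u v → +[1+ n ] ≡ nonzeroForm u v
  step n rec with even-or-odd (suc n)
  ... | h , inj₂ 1+n≡2h+1 = ℤ.- + h , 0ℤ , trans (cong +_ 1+n≡2h+1) (odd-nonzeroForm (+ h))
  ... | zero , inj₁ ()
  ... | suc h , inj₁ 1+n≡2h
    with rec {h} (ℕP.≤-trans (ℕP.m<m+n h ℕ.z<s) (ℕP.≤-reflexive (sym (ℕP.suc-injective 1+n≡2h))))
  ...   | u , v , 1+h≡ = 1ℤ ℤ.- u , 1ℤ ℤ.- + 2 ℤ.* v , (begin
    + suc n                          ≡⟨ cong +_ 1+n≡2h ⟩
    + (suc h ℕ.+ suc h)              ≡⟨ ℤP.pos-+ (suc h) (suc h) ⟩
    +[1+ h ] ℤ.+ +[1+ h ]            ≡⟨ cong₂ ℤ._+_ 1+h≡ 1+h≡ ⟩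
    nonzeroForm u v ℤ.+ nonzeroForm u v ≡⟨ double-nonzeroForm u v ⟩
    nonzeroForm (1ℤ ℤ.- u) (1ℤ ℤ.- + 2 ℤ.* v) ∎)
    where open ≡-Reasoning

nonzero⇒nonzeroForm : ∀ x → x ≢ 0ℤ → ∃₂ λ u v → x ≡ nonzeroForm u v
nonzero⇒nonzeroForm (+ zero) x≢0 = ⊥-elim (x≢0 refl)
nonzero⇒nonzeroForm +[1+ n ] _ = positive⇒nonzeroForm n
nonzero⇒nonzeroForm -[1+ n ] _ with positive⇒nonzeroForm n
... | u , v , eq = 1ℤ ℤ.- u , v , trans (cong ℤ.-_ eq) (neg-nonzeroForm u v)

_⊖_ : ∀ {n} → Poly n → Poly n → Poly n
g ⊖ h = g ⊕ (con -1ℤ ⊗ h)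

_^ᴾ_ : ∀ {n} → Poly n → ℕ → Poly n
g ^ᴾ zero = con 1ℤ
g ^ᴾ suc k = g ⊗ (g ^ᴾ k)

∑² : ∀ {n k} → (Fin k → Poly n) → Poly n
∑² {k = zero}  g = con 0ℤ
∑² {k = suc k} g = (g zero ⊗ g zero) ⊕ ∑² (g ∘ suc)

∏ : ∀ {n k} → (Fin k → Poly n) → Poly n
∏ {k = zero}  g = con 1ℤ
∏ {k = suc k} g = g zero ⊗ ∏ (g ∘ suc)

_[_] : ∀ {m n} → Poly m → (Fin m → Poly n) → Poly n
con c   [ σ ] = con c
var i   [ σ ] = σ i
(g ⊕ h) [ σ ] = (g [ σ ]) ⊕ (h [ σ ])
(g ⊗ h) [ σ ] = (g [ σ ]) ⊗ (h [ σ ])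

evalℤ-⊖ : ∀ {n} (g h : Poly n) z → evalℤ (g ⊖ h) z ≡ evalℤ g z ℤ.- evalℤ h z
evalℤ-⊖ g h z = cong (λ t → evalℤ g z ℤ.+ t) (ℤP.-1*i≡-i (evalℤ h z))

evalℤ-^ᴾ : ∀ {n} (g : Poly n) k z → evalℤ (g ^ᴾ k) z ≡ evalℤ g z ℤ.^ k
evalℤ-^ᴾ g zero    z = refl
evalℤ-^ᴾ g (suc k) z = cong (λ t → evalℤ g z ℤ.* t) (evalℤ-^ᴾ g k z)

evalℤ-[] : ∀ {m n} (g : Poly m) (σ : Fin m → Poly n) z →
           evalℤ (g [ σ ]) z ≡ evalℤ g (tabulate λ i → evalℤ (σ i) z)
evalℤ-[] (con c) σ z = refl
evalℤ-[] (var i) σ z = sym (VP.lookup∘tabulate _ i)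
evalℤ-[] (g ⊕ h) σ z = cong₂ ℤ._+_ (evalℤ-[] g σ z) (evalℤ-[] h σ z)
evalℤ-[] (g ⊗ h) σ z = cong₂ ℤ._*_ (evalℤ-[] g σ z) (evalℤ-[] h σ z)

i*i≡+∣i∣*∣i∣ : ∀ i → i ℤ.* i ≡ + (∣ i ∣ ℕ.* ∣ i ∣)
i*i≡+∣i∣*∣i∣ (+ n)    = sym (ℤP.pos-* n n)
i*i≡+∣i∣*∣i∣ -[1+ n ] = refl

i*i+n≡0⇒i≡0∧n≡0 : ∀ i n → i ℤ.* i ℤ.+ + n ≡ 0ℤ → i ≡ 0ℤ × n ≡ 0
i*i+n≡0⇒i≡0∧n≡0 i n eq =
  ℤP.∣i∣≡0⇒i≡0 ([ id , id ]′ (ℕP.m*n≡0⇒m≡0∨n≡0 ∣ i ∣ (ℕP.m+n≡0⇒m≡0 _ sum≡0))) ,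
  ℕP.m+n≡0⇒n≡0 (∣ i ∣ ℕ.* ∣ i ∣) sum≡0
  where
  sum≡0 : ∣ i ∣ ℕ.* ∣ i ∣ ℕ.+ n ≡ 0
  sum≡0 = ℤP.+-injective (trans (ℤP.pos-+ _ n) (trans (cong (ℤ._+ + n) (sym (i*i≡+∣i∣*∣i∣ i))) eq))

evalℤ-∑²≡+ : ∀ {n k} (g : Fin k → Poly n) z → ∃ λ m → evalℤ (∑² g) z ≡ + m
evalℤ-∑²≡+ {k = zero}  g z = 0 , refl
evalℤ-∑²≡+ {k = suc k} g z with evalℤ-∑²≡+ (g ∘ suc) z
... | m , eq = ∣ G ∣ ℕ.* ∣ G ∣ ℕ.+ m ,
               trans (cong₂ ℤ._+_ (i*i≡+∣i∣*∣i∣ G) eq) (sym (ℤP.pos-+ _ m))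
  where
  G : ℤ
  G = evalℤ (g zero) z

evalℤ-∑²≡0⁻ : ∀ {n k} (g : Fin k → Poly n) z → evalℤ (∑² g) z ≡ 0ℤ → ∀ i → evalℤ (g i) z ≡ 0ℤ
evalℤ-∑²≡0⁻ {k = suc k} g z eq i with evalℤ-∑²≡+ (g ∘ suc) z
... | m , rest≡m
  with i*i+n≡0⇒i≡0∧n≡0 (evalℤ (g zero) z) m
         (trans (cong (ℤ._+_ (evalℤ (g zero) z ℤ.* evalℤ (g zero) z)) (sym rest≡m)) eq)
...   | g₀≡0 , m≡0 with i
...     | zero  = g₀≡0
...     | suc i = evalℤ-∑²≡0⁻ (g ∘ suc) z (trans rest≡m (cong +_ m≡0)) i

evalℤ-∑²≡0⁺ : ∀ {n k} (g : Fin k → Poly n) z → (∀ i → evalℤ (g i) z ≡ 0ℤ) → evalℤ (∑² g) z ≡ 0ℤ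
evalℤ-∑²≡0⁺ {k = zero}  g z _ = refl
evalℤ-∑²≡0⁺ {k = suc k} g z g≡0 rewrite g≡0 zero =
  trans (ℤP.+-identityˡ _) (evalℤ-∑²≡0⁺ (g ∘ suc) z (g≡0 ∘ suc))

evalℤ-∏≢0⁻ : ∀ {n k} (g : Fin k → Poly n) z → evalℤ (∏ g) z ≢ 0ℤ → ∀ i → evalℤ (g i) z ≢ 0ℤ
evalℤ-∏≢0⁻ g z ∏≢0 zero g₀≡0 =
  ∏≢0 (trans (cong (ℤ._* evalℤ (∏ (g ∘ suc)) z) g₀≡0) (ℤP.*-zeroˡ (evalℤ (∏ (g ∘ suc)) z)))
evalℤ-∏≢0⁻ g z ∏≢0 (suc i) =
  evalℤ-∏≢0⁻ (g ∘ suc) z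
    (λ rest≡0 → ∏≢0 (trans (cong (ℤ._*_ (evalℤ (g zero) z)) rest≡0) (ℤP.*-zeroʳ (evalℤ (g zero) z)))) i

evalℤ-∏≢0⁺ : ∀ {n k} (g : Fin k → Poly n) z → (∀ i → evalℤ (g i) z ≢ 0ℤ) → evalℤ (∏ g) z ≢ 0ℤ
evalℤ-∏≢0⁺ {k = zero}  g z _ ()
evalℤ-∏≢0⁺ {k = suc k} g z g≢0 eq with ℤP.i*j≡0⇒i≡0∨j≡0 (evalℤ (g zero) z) eq
... | inj₁ g₀≡0   = g≢0 zero g₀≡0
... | inj₂ rest≡0 = evalℤ-∏≢0⁺ (g ∘ suc) z (g≢0 ∘ suc) rest≡0

-- A syntactic bound on the degree (deg (f ⊕ g) adds rather than takes the
-- maximum); homogenizing with respect to it is all that clearing denominators needs.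
deg : ∀ {p} → Poly p → ℕ
deg (con _) = 0
deg (var _) = 1
deg (f ⊕ g) = deg f ℕ.+ deg g
deg (f ⊗ g) = deg f ℕ.+ deg g

homogenize : ∀ {p} → Poly p → Poly (suc p)
homogenize (con c) = con c
homogenize (var i) = var (suc i)
homogenize (f ⊕ g) = (homogenize f ⊗ (var zero ^ᴾ deg g)) ⊕ (homogenize g ⊗ (var zero ^ᴾ deg f))
homogenize (f ⊗ g) = homogenize f ⊗ homogenize g

evalℚᵘ : ∀ {p} → Poly p → (Fin p → ℚᵘ) → ℚᵘ
evalℚᵘ (con c) y = mkℚᵘ c 0
evalℚᵘ (var i) y = y i
evalℚᵘ (f ⊕ g) y = evalℚᵘ f y ℚᵘ.+ evalℚᵘ g y
evalℚᵘ (f ⊗ g) y = evalℚᵘ f y ℚᵘ.* evalℚᵘ g y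

toℚᵘ-evalℚ : ∀ {p} (f : Poly p) x → toℚᵘ (evalℚ f x) ≃ evalℚᵘ f (toℚᵘ ∘ lookup x)
toℚᵘ-evalℚ (con c) x = ℚP.toℚᵘ-fromℚᵘ (mkℚᵘ c 0)
toℚᵘ-evalℚ (var i) x = ℚᵘP.≃-refl
toℚᵘ-evalℚ (f ⊕ g) x =
  ℚᵘP.≃-trans (ℚP.toℚᵘ-homo-+ (evalℚ f x) (evalℚ g x)) (ℚᵘP.+-cong (toℚᵘ-evalℚ f x) (toℚᵘ-evalℚ g x))
toℚᵘ-evalℚ (f ⊗ g) x =
  ℚᵘP.≃-trans (ℚP.toℚᵘ-homo-* (evalℚ f x) (evalℚ g x)) (ℚᵘP.*-cong (toℚᵘ-evalℚ f x) (toℚᵘ-evalℚ g x))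

evalℚᵘ-cong : ∀ {p} (f : Poly p) {y y′ : Fin p → ℚᵘ} → (∀ i → y i ≃ y′ i) → evalℚᵘ f y ≃ evalℚᵘ f y′
evalℚᵘ-cong (con c) y≃y′ = ℚᵘP.≃-refl
evalℚᵘ-cong (var i) y≃y′ = y≃y′ i
evalℚᵘ-cong (f ⊕ g) y≃y′ = ℚᵘP.+-cong (evalℚᵘ-cong f y≃y′) (evalℚᵘ-cong g y≃y′)
evalℚᵘ-cong (f ⊗ g) y≃y′ = ℚᵘP.*-cong (evalℚᵘ-cong f y≃y′) (evalℚᵘ-cong g y≃y′)

↥-+ : ∀ r s → ↥ (r ℚᵘ.+ s) ≡ ↥ r ℤ.* ↧ s ℤ.+ ↥ s ℤ.* ↧ r
↥-+ (mkℚᵘ _ _) (mkℚᵘ _ _) = refl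

↧-+ : ∀ r s → ↧ (r ℚᵘ.+ s) ≡ ↧ r ℤ.* ↧ s
↧-+ (mkℚᵘ _ m) (mkℚᵘ _ n) = ℤP.pos-* (suc m) (suc n)

↥-* : ∀ r s → ↥ (r ℚᵘ.* s) ≡ ↥ r ℤ.* ↥ s
↥-* (mkℚᵘ _ _) (mkℚᵘ _ _) = refl

↧-* : ∀ r s → ↧ (r ℚᵘ.* s) ≡ ↧ r ℤ.* ↧ s
↧-* (mkℚᵘ _ m) (mkℚᵘ _ n) = ℤP.pos-* (suc m) (suc n)

fractions : ∀ {p} → (Fin p → ℤ) → ℕ → Fin p → ℚᵘ
fractions a m j = mkℚᵘ (a j) m

private
  +-clear : ∀ r s r′ s′ c c′ →
    (r ℤ.* s ℤ.+ r′ ℤ.* s′) ℤ.* (c ℤ.* c′) ≡ (r ℤ.* c) ℤ.* (s ℤ.* c′) ℤ.+ (r′ ℤ.* c′) ℤ.* (s′ ℤ.* c)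
  +-clear = solve-∀
  +-collect : ∀ n d n′ d′ c c′ →
    (n ℤ.* d) ℤ.* (d′ ℤ.* c′) ℤ.+ (n′ ℤ.* d′) ℤ.* (d ℤ.* c) ≡ (n ℤ.* c′ ℤ.+ n′ ℤ.* c) ℤ.* (d ℤ.* d′)
  +-collect = solve-∀
  *-interchange : ∀ a b c d → (a ℤ.* b) ℤ.* (c ℤ.* d) ≡ (a ℤ.* c) ℤ.* (b ℤ.* d)
  *-interchange = solve-∀

↥evalℚᵘ-fractions : ∀ {p} (f : Poly p) a m →
  ↥ (evalℚᵘ f (fractions a m)) ℤ.* +[1+ m ] ℤ.^ deg f
    ≡ evalℤ (homogenize f) (+[1+ m ] ∷ tabulate a) ℤ.* ↧ (evalℚᵘ f (fractions a m))
↥evalℚᵘ-fractions (con c) a m = refl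
↥evalℚᵘ-fractions (var i) a m = cong₂ ℤ._*_ (sym (VP.lookup∘tabulate a i)) (ℤP.*-identityʳ +[1+ m ])
↥evalℚᵘ-fractions {p} (f ⊕ g) a m = begin
  ↥ (F ℚᵘ.+ G) ℤ.* c ℤ.^ (deg f ℕ.+ deg g)
    ≡⟨ cong₂ ℤ._*_ (↥-+ F G) (ℤP.^-distribˡ-+-* c (deg f) (deg g)) ⟩
  (↥ F ℤ.* ↧ G ℤ.+ ↥ G ℤ.* ↧ F) ℤ.* (cᶠ ℤ.* cᵍ)
    ≡⟨ +-clear (↥ F) (↧ G) (↥ G) (↧ F) cᶠ cᵍ ⟩
  (↥ F ℤ.* cᶠ) ℤ.* (↧ G ℤ.* cᵍ) ℤ.+ (↥ G ℤ.* cᵍ) ℤ.* (↧ F ℤ.* cᶠ)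
    ≡⟨ cong₂ (λ s t → s ℤ.* (↧ G ℤ.* cᵍ) ℤ.+ t ℤ.* (↧ F ℤ.* cᶠ))
             (↥evalℚᵘ-fractions f a m) (↥evalℚᵘ-fractions g a m) ⟩
  (Nᶠ ℤ.* ↧ F) ℤ.* (↧ G ℤ.* cᵍ) ℤ.+ (Nᵍ ℤ.* ↧ G) ℤ.* (↧ F ℤ.* cᶠ)
    ≡⟨ +-collect Nᶠ (↧ F) Nᵍ (↧ G) cᶠ cᵍ ⟩
  (Nᶠ ℤ.* cᵍ ℤ.+ Nᵍ ℤ.* cᶠ) ℤ.* (↧ F ℤ.* ↧ G)
    ≡⟨ cong₂ (λ s t → (Nᶠ ℤ.* s ℤ.+ Nᵍ ℤ.* t) ℤ.* (↧ F ℤ.* ↧ G))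
             (sym (evalℤ-^ᴾ (var zero) (deg g) z)) (sym (evalℤ-^ᴾ (var zero) (deg f) z)) ⟩
  evalℤ (homogenize (f ⊕ g)) z ℤ.* (↧ F ℤ.* ↧ G)
    ≡⟨ cong (evalℤ (homogenize (f ⊕ g)) z ℤ.*_) (sym (↧-+ F G)) ⟩
  evalℤ (homogenize (f ⊕ g)) z ℤ.* ↧ (F ℚᵘ.+ G) ∎
  where
  open ≡-Reasoning
  c Nᶠ Nᵍ cᶠ cᵍ : ℤ
  c = +[1+ m ]
  z : Vec ℤ (suc p)
  z = c ∷ tabulate a
  F G : ℚᵘ
  F = evalℚᵘ f (fractions a m)
  G = evalℚᵘ g (fractions a m)
  Nᶠ = evalℤ (homogenize f) z
  Nᵍ = evalℤ (homogenize g) z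
  cᶠ = c ℤ.^ deg f
  cᵍ = c ℤ.^ deg g
↥evalℚᵘ-fractions {p} (f ⊗ g) a m = begin
  ↥ (F ℚᵘ.* G) ℤ.* c ℤ.^ (deg f ℕ.+ deg g)
    ≡⟨ cong₂ ℤ._*_ (↥-* F G) (ℤP.^-distribˡ-+-* c (deg f) (deg g)) ⟩
  (↥ F ℤ.* ↥ G) ℤ.* (c ℤ.^ deg f ℤ.* c ℤ.^ deg g)
    ≡⟨ *-interchange (↥ F) (↥ G) (c ℤ.^ deg f) (c ℤ.^ deg g) ⟩
  (↥ F ℤ.* c ℤ.^ deg f) ℤ.* (↥ G ℤ.* c ℤ.^ deg g)
    ≡⟨ cong₂ ℤ._*_ (↥evalℚᵘ-fractions f a m) (↥evalℚᵘ-fractions g a m) ⟩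
  (Nᶠ ℤ.* ↧ F) ℤ.* (Nᵍ ℤ.* ↧ G)
    ≡⟨ *-interchange Nᶠ (↧ F) Nᵍ (↧ G) ⟩
  (Nᶠ ℤ.* Nᵍ) ℤ.* (↧ F ℤ.* ↧ G)
    ≡⟨ cong ((Nᶠ ℤ.* Nᵍ) ℤ.*_) (sym (↧-* F G)) ⟩
  (Nᶠ ℤ.* Nᵍ) ℤ.* ↧ (F ℚᵘ.* G) ∎
  where
  open ≡-Reasoning
  c Nᶠ Nᵍ : ℤ
  c = +[1+ m ]
  z : Vec ℤ (suc p)
  z = c ∷ tabulate a
  F G : ℚᵘ
  F = evalℚᵘ f (fractions a m)
  G = evalℚᵘ g (fractions a m)
  Nᶠ = evalℤ (homogenize f) z
  Nᵍ = evalℤ (homogenize g) z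

_≈_/[1+_] : ∀ {p} → Vec ℚ p → (Fin p → ℤ) → ℕ → Set
x ≈ a /[1+ m ] = ∀ j → toℚᵘ (lookup x j) ≃ mkℚᵘ (a j) m

module _ {p} (f : Poly p) {x : Vec ℚ p} {a : Fin p → ℤ} {m : ℕ} (x≈a/[1+m] : x ≈ a /[1+ m ]) where
  private
    E : ℚᵘ
    E = evalℚᵘ f (fractions a m)
    N : ℤ
    N = evalℤ (homogenize f) (+[1+ m ] ∷ tabulate a)

    toℚᵘ-evalℚ≃E : toℚᵘ (evalℚ f x) ≃ E
    toℚᵘ-evalℚ≃E = ℚᵘP.≃-trans (toℚᵘ-evalℚ f x) (evalℚᵘ-cong f x≈a/[1+m])

  evalℚ≡0⇒homogenize≡0 : evalℚ f x ≡ 0ℚ → N ≡ 0ℤ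
  evalℚ≡0⇒homogenize≡0 fx≡0 with ℤP.i*j≡0⇒i≡0∨j≡0 N (trans (sym (↥evalℚᵘ-fractions f a m)) ↥E*cᵈ≡0)
    where
    ↥E≡0 : ↥ E ≡ 0ℤ
    ↥E≡0 = ℚᵘP.p≃0⇒↥p≡0 E (ℚᵘP.≃-trans (ℚᵘP.≃-sym toℚᵘ-evalℚ≃E) (ℚP.toℚᵘ-cong fx≡0))
    ↥E*cᵈ≡0 : ↥ E ℤ.* +[1+ m ] ℤ.^ deg f ≡ 0ℤ
    ↥E*cᵈ≡0 = trans (cong (ℤ._* +[1+ m ] ℤ.^ deg f) ↥E≡0) (ℤP.*-zeroˡ (+[1+ m ] ℤ.^ deg f))
  ... | inj₁ N≡0 = N≡0
  ... | inj₂ ()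

  homogenize≡0⇒evalℚ≡0 : N ≡ 0ℤ → evalℚ f x ≡ 0ℚ
  homogenize≡0⇒evalℚ≡0 N≡0 = ℚP.toℚᵘ-injective (ℚᵘP.≃-trans toℚᵘ-evalℚ≃E (ℚᵘP.↥p≡0⇒p≃0 E ↥E≡0))
    where
    ↥E≡0 : ↥ E ≡ 0ℤ
    ↥E≡0 with ℤP.i*j≡0⇒i≡0∨j≡0 (↥ E)
                (trans (↥evalℚᵘ-fractions f a m) (trans (cong (ℤ._* ↧ E) N≡0) (ℤP.*-zeroˡ (↧ E))))
    ... | inj₁ ↥E≡0 = ↥E≡0
    ... | inj₂ cᵈ≡0 with ℤP.i^n≡0⇒i≡0 +[1+ m ] (deg f) cᵈ≡0
    ...   | ()

≡⇔cross-multiplied : ∀ {p} {x x′ : Vec ℚ p} {a a′ m m′} → x ≈ a /[1+ m ] → x′ ≈ a′ /[1+ m′ ] →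
  x ≡ x′ ⇔ (∀ j → a j ℤ.* +[1+ m′ ] ≡ a′ j ℤ.* +[1+ m ])
≡⇔cross-multiplied {x = x} {x′} x≈ x′≈ = mk⇔
  (λ { refl j → ℚᵘP.drop-*≡* (ℚᵘP.≃-trans (ℚᵘP.≃-sym (x≈ j)) (x′≈ j)) })
  (λ cross → lookup-ext λ j →
     ℚP.toℚᵘ-injective (ℚᵘP.≃-trans (x≈ j) (ℚᵘP.≃-trans (*≡* (cross j)) (ℚᵘP.≃-sym (x′≈ j)))))
  where
  lookup-ext : (∀ j → lookup x j ≡ lookup x′ j) → x ≡ x′
  lookup-ext x≗x′ = trans (sym (VP.tabulate∘lookup x)) (trans (VP.tabulate-cong x≗x′) (VP.tabulate∘lookup x′))

fractionVector : ∀ {p} (a : Fin p → ℤ) m → Σ (Vec ℚ p) (_≈ a /[1+ m ])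
fractionVector a m = tabulate (fromℚᵘ ∘ fractions a m) , λ j →
  ℚᵘP.≃-trans (ℚP.toℚᵘ-cong (VP.lookup∘tabulate (fromℚᵘ ∘ fractions a m) j)) (ℚP.toℚᵘ-fromℚᵘ (fractions a m j))

≃-rescale : ∀ n m k {M} → suc M ≡ suc k ℕ.* suc m → mkℚᵘ n m ≃ mkℚᵘ (n ℤ.* +[1+ k ]) M
≃-rescale n m k {M} eq = *≡* (begin
  n ℤ.* + suc M                ≡⟨ cong (λ t → n ℤ.* + t) eq ⟩
  n ℤ.* + (suc k ℕ.* suc m)    ≡⟨ cong (n ℤ.*_) (ℤP.pos-* (suc k) (suc m)) ⟩
  n ℤ.* (+[1+ k ] ℤ.* +[1+ m ]) ≡⟨ sym (ℤP.*-assoc n +[1+ k ] +[1+ m ]) ⟩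
  n ℤ.* +[1+ k ] ℤ.* +[1+ m ]  ∎)
  where open ≡-Reasoning

commonDenominator : ∀ {p} (x : Vec ℚ p) → ∃₂ λ a m → x ≈ a /[1+ m ]
commonDenominator [] = (λ ()) , 0 , λ ()
commonDenominator (q@(ℚ.mkℚ n d _) ∷ xs) with commonDenominator xs
... | a , e , xs≈a/e = a′ , e ℕ.+ d ℕ.* suc e , x≈a′
  where
  a′ : Fin _ → ℤ
  a′ zero    = n ℤ.* +[1+ e ]
  a′ (suc j) = a j ℤ.* +[1+ d ]
  x≈a′ : (q ∷ xs) ≈ a′ /[1+ e ℕ.+ d ℕ.* suc e ]
  x≈a′ zero    = ≃-rescale n d e (cong suc (ℕP.suc-injective (ℕP.*-comm (suc d) (suc e))))
  x≈a′ (suc j) = ℚᵘP.≃-trans (xs≈a/e j) (≃-rescale (a j) e d refl)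

nonzeroFormᴾ : ∀ {n} → Poly n → Poly n → Poly n
nonzeroFormᴾ u v = ((con (+ 2) ⊗ u) ⊖ con 1ℤ) ⊗ ((con (+ 3) ⊗ v) ⊖ con 1ℤ)

evalℤ-nonzeroFormᴾ : ∀ {n} (u v : Poly n) z → evalℤ (nonzeroFormᴾ u v) z ≡ nonzeroForm (evalℤ u z) (evalℤ v z)
evalℤ-nonzeroFormᴾ u v z = cong₂ ℤ._*_ (evalℤ-⊖ (con (+ 2) ⊗ u) (con 1ℤ) z) (evalℤ-⊖ (con (+ 3) ⊗ v) (con 1ℤ) z)

shift₂ : ∀ {n} → Poly n → Poly (suc (suc n))
shift₂ g = g [ (λ i → var (suc (suc i))) ]

evalℤ-shift₂ : ∀ {n} (g : Poly n) u v y → evalℤ (shift₂ g) (u ∷ v ∷ y) ≡ evalℤ g y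
evalℤ-shift₂ g u v y =
  trans (evalℤ-[] g (λ i → var (suc (suc i))) (u ∷ v ∷ y)) (cong (evalℤ g) (VP.tabulate∘lookup y))

i≢0⇒i*i≡+[1+_] : ∀ i → i ≢ 0ℤ → ∃ λ m → i ℤ.* i ≡ +[1+ m ]
i≢0⇒i*i≡+[1+_] (+ zero)  i≢0 = ⊥-elim (i≢0 refl)
i≢0⇒i*i≡+[1+_] +[1+ n ]  _ = n ℕ.+ n ℕ.* suc n , refl
i≢0⇒i*i≡+[1+_] -[1+ n ]  _ = n ℕ.+ n ℕ.* suc n , refl

≢0⇔nonzeroForm : ∀ {x} → x ≢ 0ℤ ⇔ (∃₂ λ u v → x ≡ nonzeroForm u v)
≢0⇔nonzeroForm {x} = mk⇔ (nonzero⇒nonzeroForm x) λ { (u , v , refl) → nonzeroForm≢0 u v }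

DistinctRatSols : DiophEq → ℕ → Set
DistinctRatSols D b = Σ (Fin b → Vec ℚ (proj₁ D)) λ S → Injective _≡_ _≡_ S × (∀ k → IsRatSol D (S k))

module Query {p} (f : Poly p) (b : ℕ) where

  Block : Set
  Block = Vec ℤ (b ℕ.* suc p)

  d : Fin b → Poly (b ℕ.* suc p)
  d k = var (combine k zero)

  a : Fin b → Fin p → Poly (b ℕ.* suc p)
  a k j = var (combine k (suc j))

  pointCoordinates : Fin b → Fin (suc p) → Poly (b ℕ.* suc p)
  pointCoordinates k zero    = d k ⊗ d k
  pointCoordinates k (suc j) = a k j

  pointEquation : Fin b → Poly (b ℕ.* suc p)
  pointEquation k = homogenize f [ pointCoordinates k ]

  separation : Fin b → Fin b → Poly (b ℕ.* suc p)
  separation k l = ∑² λ j → (a k j ⊗ (d l ⊗ d l)) ⊖ (a l j ⊗ (d k ⊗ d k))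

  nondegeneracyFactor : Fin b → Fin b → Poly (b ℕ.* suc p)
  nondegeneracyFactor k l with k F.≟ l
  ... | yes _ = d k
  ... | no  _ = separation k l

  nondegeneracy : Poly (b ℕ.* suc p)
  nondegeneracy = ∏ λ k → ∏ (nondegeneracyFactor k)

  nonzeroFormᵘᵛ : Poly (suc (suc (b ℕ.* suc p)))
  nonzeroFormᵘᵛ = nonzeroFormᴾ (var zero) (var (suc zero))

  condition : Fin (suc b) → Poly (suc (suc (b ℕ.* suc p)))
  condition zero    = shift₂ nondegeneracy ⊖ nonzeroFormᵘᵛ
  condition (suc k) = shift₂ (pointEquation k)

  equation : DiophEq
  equation = suc (suc (b ℕ.* suc p)) , ∑² condition

  -- The denominator is d_k² rather than d_k so that it is positive.
  record Encodes (y : Block) (S : Fin b → Vec ℚ p) : Set where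
    field
      m          : Fin b → ℕ
      d²≡1+m     : ∀ k → evalℤ (d k) y ℤ.* evalℤ (d k) y ≡ +[1+ m k ]
      S≈a/[1+m]  : ∀ k → S k ≈ (λ j → evalℤ (a k j) y) /[1+ m k ]

  module _ {y : Block} {S : Fin b → Vec ℚ p} (enc : Encodes y S) where
    open Encodes enc

    d≢0 : ∀ k → evalℤ (d k) y ≢ 0ℤ
    d≢0 k d≡0 with trans (sym (d²≡1+m k)) (cong (λ t → t ℤ.* t) d≡0)
    ... | ()

    pointEquation≡0⇔ : ∀ k → evalℤ (pointEquation k) y ≡ 0ℤ ⇔ IsRatSol (p , f) (S k)
    pointEquation≡0⇔ k rewrite evalℤ-[] (homogenize f) (pointCoordinates k) y | d²≡1+m k =
      mk⇔ (homogenize≡0⇒evalℚ≡0 f (S≈a/[1+m] k)) (evalℚ≡0⇒homogenize≡0 f (S≈a/[1+m] k))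

    separation≡0⇔ : ∀ k l → evalℤ (separation k l) y ≡ 0ℤ ⇔ S k ≡ S l
    separation≡0⇔ k l = mk⇔
      (λ sep≡0 → Equivalence.from S≡⇔ λ j →
         cross⁻ j (ℤP.i-j≡0⇒i≡j _ _ (trans (sym (evalℤ-⊖ (lhs j) (rhs j) y)) (evalℤ-∑²≡0⁻ _ y sep≡0 j))))
      (λ Sk≡Sl → evalℤ-∑²≡0⁺ _ y λ j →
         trans (evalℤ-⊖ (lhs j) (rhs j) y) (ℤP.i≡j⇒i-j≡0 (cross⁺ j (Equivalence.to S≡⇔ Sk≡Sl j))))
      where
      S≡⇔ : S k ≡ S l ⇔ (∀ j → evalℤ (a k j) y ℤ.* +[1+ m l ] ≡ evalℤ (a l j) y ℤ.* +[1+ m k ])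
      S≡⇔ = ≡⇔cross-multiplied (S≈a/[1+m] k) (S≈a/[1+m] l)
      lhs rhs : Fin p → Poly (b ℕ.* suc p)
      lhs j = a k j ⊗ (d l ⊗ d l)
      rhs j = a l j ⊗ (d k ⊗ d k)
      cross⁻ : ∀ j → evalℤ (lhs j) y ≡ evalℤ (rhs j) y →
               evalℤ (a k j) y ℤ.* +[1+ m l ] ≡ evalℤ (a l j) y ℤ.* +[1+ m k ]
      cross⁻ j rewrite d²≡1+m k | d²≡1+m l = id
      cross⁺ : ∀ j → evalℤ (a k j) y ℤ.* +[1+ m l ] ≡ evalℤ (a l j) y ℤ.* +[1+ m k ] →
               evalℤ (lhs j) y ≡ evalℤ (rhs j) y
      cross⁺ j rewrite d²≡1+m k | d²≡1+m l = id

  module _ (y : Block) where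
    nondegeneracyFactor≢0⇔ : ∀ k l →
      evalℤ (nondegeneracyFactor k l) y ≢ 0ℤ ⇔
      ((k ≡ l → evalℤ (d k) y ≢ 0ℤ) × (k ≢ l → evalℤ (separation k l) y ≢ 0ℤ))
    nondegeneracyFactor≢0⇔ k l with k F.≟ l
    ... | yes k≡l = mk⇔ (λ d≢0 → (λ _ → d≢0) , λ k≢l → ⊥-elim (k≢l k≡l)) (λ (d≢0 , _) → d≢0 k≡l)
    ... | no  k≢l = mk⇔ (λ sep≢0 → (λ k≡l → ⊥-elim (k≢l k≡l)) , λ _ → sep≢0) (λ (_ , sep≢0) → sep≢0 k≢l)

    nondegeneracy≢0⇔ : evalℤ nondegeneracy y ≢ 0ℤ ⇔
      ((∀ k → evalℤ (d k) y ≢ 0ℤ) × (∀ k l → k ≢ l → evalℤ (separation k l) y ≢ 0ℤ))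
    nondegeneracy≢0⇔ = mk⇔
      (λ nd≢0 → (λ k → proj₁ (factor nd≢0 k k) refl) , λ k l → proj₂ (factor nd≢0 k l))
      (λ (d≢0 , sep≢0) → evalℤ-∏≢0⁺ _ y λ k → evalℤ-∏≢0⁺ _ y λ l →
         Equivalence.from (nondegeneracyFactor≢0⇔ k l) ((λ { refl → d≢0 k }) , sep≢0 k l))
      where
      factor : evalℤ nondegeneracy y ≢ 0ℤ → ∀ k l →
               (k ≡ l → evalℤ (d k) y ≢ 0ℤ) × (k ≢ l → evalℤ (separation k l) y ≢ 0ℤ)
      factor nd≢0 k l = Equivalence.to (nondegeneracyFactor≢0⇔ k l) (evalℤ-∏≢0⁻ _ y (evalℤ-∏≢0⁻ _ y nd≢0 k) l)

    decode : (∀ k → evalℤ (d k) y ≢ 0ℤ) → Σ (Fin b → Vec ℚ p) (Encodes y)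
    decode d≢0 = (λ k → proj₁ (point k)) , record
      { m = m ; d²≡1+m = λ k → proj₂ (i≢0⇒i*i≡+[1+_] _ (d≢0 k)) ; S≈a/[1+m] = λ k → proj₂ (point k) }
      where
      m : Fin b → ℕ
      m k = proj₁ (i≢0⇒i*i≡+[1+_] _ (d≢0 k))
      point : ∀ k → Σ (Vec ℚ p) (_≈ (λ j → evalℤ (a k j) y) /[1+ m k ])
      point k = fractionVector (λ j → evalℤ (a k j) y) (m k)

  encode : (S : Fin b → Vec ℚ p) → Σ Block λ y → Encodes y S
  encode S = y , record { m = m ; d²≡1+m = d²≡1+m ; S≈a/[1+m] = S≈ }
    where
    numerator : Fin b → Fin p → ℤ
    numerator k = proj₁ (commonDenominator (S k))
    e : Fin b → ℕ
    e k = proj₁ (proj₂ (commonDenominator (S k)))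
    m : Fin b → ℕ
    m k = e k ℕ.+ e k ℕ.* suc (e k)
    entry : Fin b → Fin (suc p) → ℤ
    entry k zero    = +[1+ e k ]
    entry k (suc j) = numerator k j ℤ.* +[1+ e k ]
    y : Block
    y = tabulate λ i → let (k , j) = remQuot (suc p) i in entry k j
    lookup-y : ∀ k j → lookup y (combine k j) ≡ entry k j
    lookup-y k j = trans (VP.lookup∘tabulate _ (combine k j)) (cong (λ (k , j) → entry k j) (FP.remQuot-combine k j))
    d²≡1+m : ∀ k → evalℤ (d k) y ℤ.* evalℤ (d k) y ≡ +[1+ m k ]
    d²≡1+m k rewrite lookup-y k zero = refl
    S≈ : ∀ k → S k ≈ (λ j → evalℤ (a k j) y) /[1+ m k ]
    S≈ k j rewrite lookup-y k (suc j) =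
      ℚᵘP.≃-trans (proj₂ (proj₂ (commonDenominator (S k))) j) (≃-rescale (numerator k j) (e k) (e k) refl)

  NondegenerateBlock : Set
  NondegenerateBlock = ∃ λ (y : Block) → evalℤ nondegeneracy y ≢ 0ℤ × (∀ k → evalℤ (pointEquation k) y ≡ 0ℤ)

  evalℤ-condition₀ : ∀ u v y → evalℤ (condition zero) (u ∷ v ∷ y) ≡ evalℤ nondegeneracy y ℤ.- nonzeroForm u v
  evalℤ-condition₀ u v y = trans (evalℤ-⊖ (shift₂ nondegeneracy) nonzeroFormᵘᵛ (u ∷ v ∷ y))
    (cong₂ ℤ._-_ (evalℤ-shift₂ nondegeneracy u v y) (evalℤ-nonzeroFormᴾ (var zero) (var (suc zero)) (u ∷ v ∷ y)))

  hasIntSol⇔nondegenerateBlock : HasIntSol equation ⇔ NondegenerateBlock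
  hasIntSol⇔nondegenerateBlock = mk⇔ to from
    where
    to : HasIntSol equation → NondegenerateBlock
    to (u ∷ v ∷ y , eq) = y , nd≢0 , λ k → trans (sym (evalℤ-shift₂ (pointEquation k) u v y)) (conditions (suc k))
      where
      conditions : ∀ i → evalℤ (condition i) (u ∷ v ∷ y) ≡ 0ℤ
      conditions = evalℤ-∑²≡0⁻ condition (u ∷ v ∷ y) eq
      nd≢0 : evalℤ nondegeneracy y ≢ 0ℤ
      nd≢0 = Equivalence.from ≢0⇔nonzeroForm
        (u , v , ℤP.i-j≡0⇒i≡j _ _ (trans (sym (evalℤ-condition₀ u v y)) (conditions zero)))
    from : NondegenerateBlock → HasIntSol equation
    from (y , nd≢0 , pe≡0) with Equivalence.to ≢0⇔nonzeroForm nd≢0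
    ... | u , v , nd≡nonzeroForm = u ∷ v ∷ y , evalℤ-∑²≡0⁺ condition (u ∷ v ∷ y) conditions
      where
      conditions : ∀ i → evalℤ (condition i) (u ∷ v ∷ y) ≡ 0ℤ
      conditions zero    = trans (evalℤ-condition₀ u v y) (ℤP.i≡j⇒i-j≡0 nd≡nonzeroForm)
      conditions (suc k) = trans (evalℤ-shift₂ (pointEquation k) u v y) (pe≡0 k)

  nondegenerateBlock⇔distinctRatSols : NondegenerateBlock ⇔ DistinctRatSols (p , f) b
  nondegenerateBlock⇔distinctRatSols = mk⇔ to from
    where
    to : NondegenerateBlock → DistinctRatSols (p , f) b
    to (y , nd≢0 , pe≡0) = S , injective , λ k → Equivalence.to (pointEquation≡0⇔ enc k) (pe≡0 k)
      where
      d≢0,sep≢0 : (∀ k → evalℤ (d k) y ≢ 0ℤ) × (∀ k l → k ≢ l → evalℤ (separation k l) y ≢ 0ℤ)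
      d≢0,sep≢0 = Equivalence.to (nondegeneracy≢0⇔ y) nd≢0
      S : Fin b → Vec ℚ p
      S = proj₁ (decode y (proj₁ d≢0,sep≢0))
      enc : Encodes y S
      enc = proj₂ (decode y (proj₁ d≢0,sep≢0))
      injective : Injective _≡_ _≡_ S
      injective {k} {l} Sk≡Sl with k F.≟ l
      ... | yes k≡l = k≡l
      ... | no  k≢l = ⊥-elim (proj₂ d≢0,sep≢0 k l k≢l (Equivalence.from (separation≡0⇔ enc k l) Sk≡Sl))
    from : DistinctRatSols (p , f) b → NondegenerateBlock
    from (S , injective , sols) = y , nd≢0 , λ k → Equivalence.from (pointEquation≡0⇔ enc k) (sols k)
      where
      y : Block
      y = proj₁ (encode S)
      enc : Encodes y S
      enc = proj₂ (encode S)
      nd≢0 : evalℤ nondegeneracy y ≢ 0ℤ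
      nd≢0 = Equivalence.from (nondegeneracy≢0⇔ y)
        (d≢0 enc , λ k l k≢l sep≡0 → k≢l (injective (Equivalence.to (separation≡0⇔ enc k l) sep≡0)))

  hasIntSol⇔distinctRatSols : HasIntSol equation ⇔ DistinctRatSols (p , f) b
  hasIntSol⇔distinctRatSols = nondegenerateBlock⇔distinctRatSols ⇔-∘ hasIntSol⇔nondegenerateBlock

module _ {A : Set} {P : A → Set} where

  injectiveFamily⇒≤length : ∀ {b} (xs : List A) → (∀ x → P x → x ∈ xs) →
    (S : Fin b → A) → Injective _≡_ _≡_ S → (∀ k → P (S k)) → b ≤ length xs
  injectiveFamily⇒≤length xs complete S S-injective PS = FP.injective⇒≤ position-injective
    where
    position : ∀ k → S k ∈ xs
    position k = complete (S k) (PS k)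
    position-injective : Injective _≡_ _≡_ (Any.index ∘ position)
    position-injective {k} {l} eq = S-injective (begin
      S k                          ≡⟨ lookup-index (position k) ⟩
      List.lookup xs (Any.index (position k)) ≡⟨ cong (List.lookup xs) eq ⟩
      List.lookup xs (Any.index (position l)) ≡⟨ lookup-index (position l) ⟨
      S l                          ∎)
      where open ≡-Reasoning

  unique⇒lookup-injective : ∀ {xs : List A} → Unique xs → Injective _≡_ _≡_ (List.lookup xs)
  unique⇒lookup-injective (_   ∷ _) {zero}  {zero}  _  = refl
  unique⇒lookup-injective (x∉xs ∷ _) {zero}  {suc j} eq = ⊥-elim (All.lookup x∉xs (∈-lookup j) eq)
  unique⇒lookup-injective (x∉xs ∷ _) {suc i} {zero}  eq = ⊥-elim (All.lookup x∉xs (∈-lookup i) (sym eq))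
  unique⇒lookup-injective (_ ∷ xs-unique) {suc i} {suc j} eq = cong suc (unique⇒lookup-injective xs-unique eq)

  Enumerable : Set
  Enumerable = ∃ λ xs → Unique xs × All P xs × (∀ x → P x → x ∈ xs)

  ¬enumerable⇒uniqueLists : ExcludedMiddle 0ℓ → ¬ Enumerable →
    ∀ n → ∃ λ xs → Unique xs × All P xs × length xs ≡ n
  ¬enumerable⇒uniqueLists em ¬enum zero = [] , [] , [] , refl
  ¬enumerable⇒uniqueLists em ¬enum (suc n) with ¬enumerable⇒uniqueLists em ¬enum n
  ... | xs , unique , all , refl with em {∃ λ x → P x × x ∉ xs}
  ...   | yes (x , Px , x∉xs) =
    x ∷ xs , All.tabulate (λ y∈xs x≡y → x∉xs (subst (_∈ xs) (sym x≡y) y∈xs)) ∷ unique , Px ∷ all , refl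
  ...   | no ¬new = ⊥-elim (¬enum (xs , unique , all , complete))
    where
    complete : ∀ x → P x → x ∈ xs
    complete x Px with em {x ∈ xs}
    ... | yes x∈xs = x∈xs
    ... | no  x∉xs = ⊥-elim (¬new (x , Px , x∉xs))

  ¬enumerable⇒injectiveFamily : ExcludedMiddle 0ℓ → ¬ Enumerable →
    ∀ b → Σ (Fin b → A) λ S → Injective _≡_ _≡_ S × (∀ k → P (S k))
  ¬enumerable⇒injectiveFamily em ¬enum b with ¬enumerable⇒uniqueLists em ¬enum b
  ... | xs , unique , all , refl =
    List.lookup xs , unique⇒lookup-injective unique , λ k → All.lookup all (∈-lookup k)

finitelyMany⇔¬hasIntSol : ExcludedMiddle 0ℓ → ∀ D b → (∀ n → RatSolCount D n → n < b) →
  FinitelyManyRatSols D ⇔ (¬ HasIntSol (Query.equation (proj₂ D) b))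
finitelyMany⇔¬hasIntSol em D@(_ , f) b bound = mk⇔
  (λ { (n , count@(xs , _ , _ , complete , refl)) sol →
         let (S , S-injective , sols) = Equivalence.to (Query.hasIntSol⇔distinctRatSols f b) sol
         in ℕP.<⇒≱ (bound n count) (injectiveFamily⇒≤length xs complete S S-injective sols) })
  (λ ¬sol → decidable-stable em λ ¬finite →
     ¬sol (Equivalence.from (Query.hasIntSol⇔distinctRatSols f b)
             (¬enumerable⇒injectiveFamily em
               (λ (xs , unique , all , complete) → ¬finite (length xs , xs , unique , all , complete , refl)) b)))

not≡true⇔≢true : ∀ x → not x ≡ true ⇔ x ≢ true
not≡true⇔≢true false = mk⇔ (λ _ ()) (λ _ → refl)
not≡true⇔≢true true  = mk⇔ (λ ()) (λ true≢true → ⊥-elim (true≢true refl))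

¬-cong-⇔ : ∀ {A B : Set} → A ⇔ B → (¬ A) ⇔ (¬ B)
¬-cong-⇔ A⇔B = mk⇔ (λ ¬A b → ¬A (Equivalence.from A⇔B b)) (λ ¬B a → ¬B (Equivalence.to A⇔B a))

corollary6 : (B : DiophEq → ℕ) →
    (∀ D → 2 ≤ B D) →
    (∀ D n → RatSolCount D n → n < B D) →
    Σ (DiophEq → DiophEq) λ query →
    Σ (DiophEq → Bool → Bool) λ decide →
      ExcludedMiddle 0ℓ →
      ∀ D (answer : Bool) →
      (answer ≡ true ⇔ HasIntSol (query D)) →
      (decide D answer ≡ true ⇔ FinitelyManyRatSols D)
corollary6 B _ bound = query , (λ _ → not) , correct
  where
  query : DiophEq → DiophEq
  query D = Query.equation (proj₂ D) (B D)
  correct : ExcludedMiddle 0ℓ → ∀ D answer → (answer ≡ true ⇔ HasIntSol (query D)) →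
            not answer ≡ true ⇔ FinitelyManyRatSols D
  correct em D answer answer⇔ =
    ⇔-sym (finitelyMany⇔¬hasIntSol em D (B D) (bound D)) ⇔-∘ (¬-cong-⇔ answer⇔ ⇔-∘ not≡true⇔≢true answer)
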